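{- Let $n\ge 2$. The number of parking functions of $1,\ldots,n$ for which the second spot is lucky is \[ \sum_{i=1}^nq_n(i,2)=\tfrac34(n+1)^{n-1}-\tfrac14(n-1)^{n-1}. \]
   Context: There are $n$ spots labeled $1,\ldots,n$ in order along a one-way street, and $n$ cars entering one after another, car $i$ having preference $a_i\in\{1,\ldots,n\}$. Each car drives to its preferred spot and parks there if it is available; otherwise it moves forward and parks in the first available later spot, if any (if none, it fails to park). A parking function of $1,\ldots,n$ is a sequence of preferences $(a_1,\ldots,a_n)$ such that all $n$ cars are able to park. A car is lucky if it parks in its preferred spot; a spot is lucky if the car that parks in it prefers that spot. For $1\le i,j\le n$, $q_n(i,j)$ denotes the number of parking functions of $1,\ldots,n$ in which the $i$-th car prefers the $j$-th spot and the $i$-th car is lucky. -}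

module Defs where

open import Data.Fin using (Fin; zero; suc)
open import Data.Fin.Properties using (all?; any?; _≟_)
open import Data.Fin.Subset using (Subset; ⊥; inside; outside)
open import Data.List using (List; []; _∷_; allFin; cartesianProductWith; filter; length)
open import Data.Maybe using (Maybe; just; nothing; map)
open import Data.Maybe.Properties using (≡-dec)
open import Data.Nat using (ℕ; zero; suc)
open import Data.Product using (_×_; ∃-syntax)
open import Data.Vec using (Vec; []; _∷_; lookup; _[_]≔_)
open import Relation.Binary.PropositionalEquality using (_≡_)
open import Relation.Nullary.Decidable using (Dec; _×-dec_)
open import Relation.Unary using (Decidable)

-- Spots and cars are numbered from 0, so spot j of the street is the element
-- j - 1 of Fin n.  A street is the subset of its occupied spots.

-- The spot taken by a car with the given preference: the first unoccupied spot
-- at or after it, or nothing if there is none.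
park : ∀ {n} → Subset n → Fin n → Maybe (Fin n)
park (outside ∷ s)           zero    = just zero
park (inside  ∷ [])          zero    = nothing
park (inside  ∷ s@(_ ∷ _))   zero    = map suc (park s zero)
park (_       ∷ s)           (suc a) = map suc (park s a)

occupy : ∀ {n} → Subset n → Maybe (Fin n) → Subset n
occupy s (just k) = s [ k ]≔ inside
occupy s nothing  = s

-- Where each car ends up when the cars enter in order.
outcome : ∀ {n m} → Subset n → Vec (Fin n) m → Vec (Maybe (Fin n)) m
outcome s []       = []
outcome s (a ∷ as) = park s a ∷ outcome (occupy s (park s a)) as

Preferences : ℕ → Set
Preferences n = Vec (Fin n) n

ParksIn : ∀ {n} → Preferences n → Fin n → Fin n → Set
ParksIn a i j = lookup (outcome ⊥ a) i ≡ just j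

IsParkingFunction : ∀ {n} → Preferences n → Set
IsParkingFunction a = ∀ i → ∃[ j ] ParksIn a i j

LuckyCar : ∀ {n} → Preferences n → Fin n → Set
LuckyCar a i = ParksIn a i (lookup a i)

LuckySpot : ∀ {n} → Preferences n → Fin n → Set
LuckySpot a j = ∃[ i ] (ParksIn a i j × lookup a i ≡ j)

parksIn? : ∀ {n} (a : Preferences n) i j → Dec (ParksIn a i j)
parksIn? a i j = ≡-dec _≟_ (lookup (outcome ⊥ a) i) (just j)

isParkingFunction? : ∀ {n} → Decidable (IsParkingFunction {n})
isParkingFunction? a = all? λ i → any? λ j → parksIn? a i j

luckyCar? : ∀ {n} (a : Preferences n) i → Dec (LuckyCar a i)
luckyCar? a i = parksIn? a i (lookup a i)

luckySpot? : ∀ {n} (a : Preferences n) j → Dec (LuckySpot a j)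
luckySpot? a j = any? λ i → parksIn? a i j ×-dec (lookup a i ≟ j)

-- Every vector over the given list of entries, each exactly once when the
-- list has no repetitions.
allVecs : ∀ {A : Set} → List A → ∀ m → List (Vec A m)
allVecs xs zero    = [] ∷ []
allVecs xs (suc m) = cartesianProductWith _∷_ xs (allVecs xs m)

count : ∀ {n} {P : Preferences n → Set} → Decidable P → ℕ
count {n} P? = length (filter P? (allVecs (allFin n) n))

q : ∀ n → Fin n → Fin n → ℕ
q n i j = count {n} λ a →
  isParkingFunction? a ×-dec ((lookup a i ≟ j) ×-dec luckyCar? a i)

luckySpotCount : ∀ n → Fin n → ℕ
luckySpotCount n j = count {n} λ a → isParkingFunction? a ×-dec luckySpot? a j

{-# OPTIONS --safe #-}

-- Sweep the street from left to right, keeping only the number of cars that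
-- drive past each spot: preferences form a parking function iff no car drives
-- past the last one.  Splitting off the cars that prefer the first spot gives a
-- binomial recursion solved by (n+1)ⁿ − n (n+1)ⁿ⁻¹ = (n+1)ⁿ⁻¹.
--
-- The second spot is unlucky iff, among the cars preferring spots 1 and 2, the
-- first two prefer spot 1.  If k cars prefer spots 1 and 2, parking functions
-- allow 2ᵏ − 1 words on these letters (all but 2…2), and 2ᵏ⁻² are unlucky.  Hence
-- 4 · #unlucky is the sum of 2ᵏ over the choices of the other preferences, which
-- the same binomial recursion evaluates to (n+1)ⁿ⁻¹ + (n−1)ⁿ⁻¹.
module Submission where

open import Defs
open import Data.Bool using (Bool; true; false; if_then_else_)
open import Data.Fin using (Fin; zero; suc; fromℕ<)
open import Data.Fin.Properties using (_≟_; suc-injective)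
open import Data.Fin.Subset using (Subset; ⊥; inside; outside)
import Data.Integer as ℤ
import Data.Integer.Properties as ℤ
open import Data.Integer.Solver using () renaming (module +-*-Solver to ℤ-Solver)
open import Data.List using (List; []; _∷_; _++_; map; allFin; length; filter; cartesianProductWith; tabulate)
open import Data.List.Properties using (map-++; map-∘; map-cong; map-tabulate)
open import Data.Maybe using (Maybe; just; nothing)
import Data.Maybe as Maybe
open import Data.Nat using (ℕ; zero; suc; pred; z≤n; s≤s; _≤_; _<_; _+_; _∸_; _^_)
import Data.Nat as ℕ
open import Data.Nat.ListAction using (sum)
open import Data.Nat.ListAction.Properties using (sum-++)
open import Data.Nat.Properties hiding (_≟_; suc-injective)
open import Data.Nat.Solver using (module +-*-Solver)
open import Data.Product using (_×_; _,_; ∃-syntax; proj₂)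
open import Data.Rational using (toℚᵘ)
import Data.Rational as ℚ
import Data.Rational.Properties as ℚ
open import Data.Rational.Unnormalised using (ℚᵘ; mkℚᵘ; *≡*; _≃_)
import Data.Rational.Unnormalised as ℚᵘ
import Data.Rational.Unnormalised.Properties as ℚᵘ
open import Data.Vec using (Vec; []; _∷_; lookup; toList)
open import Data.Vec.Properties using (lookup∘update; lookup∘update′)
open import Function using (_∘_; id)
open import Relation.Binary.PropositionalEquality
open import Relation.Nullary using (¬_; contradiction; Dec; yes; no; does)
open import Relation.Nullary.Decidable using (_×-dec_)
open import Relation.Unary using (Decidable)

open import Algebra.Properties.Semiring.Sum +-*-semiring
  using (sum-cong-≗; ∑-distrib-+; *-distribˡ-sum; sum-replicate-zero) renaming (sum to ∑)
open ≡-Reasoning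

-- Binomial sums of powers and their derivatives.

module Counting where

  open import Data.Nat using (_*_)
  import Data.Nat.Properties as ℕ
  open +-*-Solver using (solve; _:+_; _:*_; _:=_; con)

  -- The sum Σ_{t+j=m} C(m,t) cᵗ f(t,j), by Pascal's rule.
  binomial : ℕ → ℕ → (ℕ → ℕ → ℕ) → ℕ
  binomial c zero    f = f 0 0
  binomial c (suc m) f =
    c * binomial c m (λ t j → f (suc t) j) + binomial c m (λ t j → f t (suc j))

  binomial-cong : ∀ c m {f g} → (∀ t j → t + j ≡ m → f t j ≡ g t j) →
                  binomial c m f ≡ binomial c m g
  binomial-cong c zero    f≡g = f≡g 0 0 refl
  binomial-cong c (suc m) f≡g = cong₂ (λ x y → c * x + y)
    (binomial-cong c m λ t j t+j≡m → f≡g (suc t) j (cong suc t+j≡m))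
    (binomial-cong c m λ t j t+j≡m → f≡g t (suc j) (trans (+-suc t j) (cong suc t+j≡m)))

  binomial-+ : ∀ c m f g → binomial c m (λ t j → f t j + g t j) ≡ binomial c m f + binomial c m g
  binomial-+ c zero    f g = refl
  binomial-+ c (suc m) f g = trans
    (cong₂ (λ x y → c * x + y) (binomial-+ c m _ _) (binomial-+ c m _ _))
    (solve 5 (λ c x y z w → c :* (x :+ y) :+ (z :+ w) := (c :* x :+ z) :+ (c :* y :+ w)) refl
      c (binomial c m _) (binomial c m _) (binomial c m _) (binomial c m _))

  binomial-* : ∀ c m y f → binomial c m (λ t j → y * f t j) ≡ y * binomial c m f
  binomial-* c zero    y f = refl
  binomial-* c (suc m) y f = trans
    (cong₂ (λ x y → c * x + y) (binomial-* c m y _) (binomial-* c m y _))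
    (solve 4 (λ c y u v → c :* (y :* u) :+ y :* v := y :* (c :* u :+ v)) refl
      c y (binomial c m _) (binomial c m _))

  binomial-0 : ∀ c m → binomial c m (λ _ _ → 0) ≡ 0
  binomial-0 c m = binomial-* c m 0 (λ _ _ → 0)

  binomial-∑ : ∀ c m {n} (f : Fin n → ℕ → ℕ → ℕ) →
               ∑ (λ a → binomial c m (f a)) ≡ binomial c m (λ t j → ∑ (λ a → f a t j))
  binomial-∑ c m {zero}  f = sym (binomial-0 c m)
  binomial-∑ c m {suc n} f = trans
    (cong (binomial c m (f zero) +_) (binomial-∑ c m (f ∘ suc)))
    (sym (binomial-+ c m (f zero) _))

  binomial-power : ∀ c m y → binomial c m (λ _ j → y ^ j) ≡ (c + y) ^ m
  binomial-power c zero    y = refl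
  binomial-power c (suc m) y = begin
    c * binomial c m (λ _ j → y ^ j) + binomial c m (λ _ j → y * y ^ j)
      ≡⟨ cong (c * binomial c m (λ _ j → y ^ j) +_) (binomial-* c m y (λ _ j → y ^ j)) ⟩
    c * binomial c m (λ _ j → y ^ j) + y * binomial c m (λ _ j → y ^ j)
      ≡⟨ *-distribʳ-+ (binomial c m (λ _ j → y ^ j)) c y ⟨
    (c + y) * binomial c m (λ _ j → y ^ j)
      ≡⟨ cong ((c + y) *_) (binomial-power c m y) ⟩
    (c + y) * (c + y) ^ m ∎

  -- The derivative of yᵐ.
  ∂power : ℕ → ℕ → ℕ
  ∂power zero    y = 0
  ∂power (suc m) y = suc m * y ^ m

  -- The product rule for `y * y ^ m`.
  ∂power-suc : ∀ m y → ∂power (suc m) y ≡ y ^ m + y * ∂power m y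
  ∂power-suc zero    y = cong suc (sym (*-zeroʳ y))
  ∂power-suc (suc m) y = cong (y ^ suc m +_)
    (solve 3 (λ m y p → m :* (y :* p) := y :* (m :* p)) refl (suc m) y (y ^ m))

  -- This is `binomial-power` differentiated in `y`.
  binomial-∂power : ∀ c m y → binomial c m (λ _ j → ∂power j y) ≡ ∂power m (c + y)
  binomial-∂power c zero    y = refl
  binomial-∂power c (suc m) y = begin
    c * D + binomial c m (λ _ j → ∂power (suc j) y)
      ≡⟨ cong (c * D +_) (binomial-cong c m λ _ j _ → ∂power-suc j y) ⟩
    c * D + binomial c m (λ _ j → y ^ j + y * ∂power j y)
      ≡⟨ cong (c * D +_) (binomial-+ c m _ _) ⟩
    c * D + (binomial c m (λ _ j → y ^ j) + binomial c m (λ _ j → y * ∂power j y))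
      ≡⟨ cong (c * D +_) (cong₂ _+_ (binomial-power c m y) (binomial-* c m y _)) ⟩
    c * D + ((c + y) ^ m + y * D)
      ≡⟨ solve 4 (λ c d p y → c :* d :+ (p :+ y :* d) := p :+ (c :+ y) :* d) refl
           c D ((c + y) ^ m) y ⟩
    (c + y) ^ m + (c + y) * D
      ≡⟨ cong (λ d → (c + y) ^ m + (c + y) * d) (binomial-∂power c m y) ⟩
    (c + y) ^ m + (c + y) * ∂power m (c + y)
      ≡⟨ ∂power-suc m (c + y) ⟨
    ∂power (suc m) (c + y) ∎
    where D = binomial c m (λ _ j → ∂power j y)

  atZero : ℕ → ℕ → ℕ
  atZero h zero    = h
  atZero h (suc _) = 0

  -- Only the term `t = 0` survives, and its weight C(m,0) c⁰ is 1.
  binomial-atZero : ∀ c m h → binomial c m (λ t _ → atZero h t) ≡ h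
  binomial-atZero c zero    h = refl
  binomial-atZero c (suc m) h = trans
    (cong₂ (λ x y → c * x + y) (binomial-0 c m) (binomial-atZero c m h))
    (cong (_+ h) (*-zeroʳ c))

  -- Splitting words by their low letters.

  words : (n m : ℕ) → (List (Fin n) → ℕ) → ℕ
  words n zero    f = f []
  words n (suc m) f = ∑ λ a → words n m (f ∘ (a ∷_))

  words-cong : ∀ n m {f g} → (∀ w → length w ≡ m → f w ≡ g w) → words n m f ≡ words n m g
  words-cong n zero    f≡g = f≡g [] refl
  words-cong n (suc m) f≡g = sum-cong-≗ λ a → words-cong n m λ w |w|≡m → f≡g (a ∷ w) (cong suc |w|≡m)

  words-0 : ∀ n m → words n m (λ _ → 0) ≡ 0
  words-0 n zero    = refl
  words-0 n (suc m) = trans (sum-cong-≗ {n} λ a → words-0 n m) (sum-replicate-zero n)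

  words-+ : ∀ n m f g → words n m (λ w → f w + g w) ≡ words n m f + words n m g
  words-+ n zero    f g = refl
  words-+ n (suc m) f g = trans (sum-cong-≗ {n} λ a → words-+ n m _ _) (∑-distrib-+ {n} _ _)

  zeros : ∀ {n} → List (Fin (suc n)) → ℕ
  zeros []          = 0
  zeros (zero  ∷ w) = suc (zeros w)
  zeros (suc _ ∷ w) = zeros w

  -- The letters are shifted down, so they become preferences on the street without its first spot.
  -- The length of the result depends on the letters, hence lists rather than vectors.
  nonzeros : ∀ {n} → List (Fin (suc n)) → List (Fin n)
  nonzeros []          = []
  nonzeros (zero  ∷ w) = nonzeros w
  nonzeros (suc a ∷ w) = a ∷ nonzeros w

  length-zeros : ∀ {n} (w : List (Fin (suc n))) → zeros w + length (nonzeros w) ≡ length w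
  length-zeros []          = refl
  length-zeros (zero  ∷ w) = cong suc (length-zeros w)
  length-zeros (suc a ∷ w) = trans (+-suc (zeros w) _) (cong suc (length-zeros w))

  ∑-words : ∀ c m n (G : ℕ → List (Fin n) → ℕ) →
            ∑ (λ a → binomial c m (λ t j → words n j (G t ∘ (a ∷_)))) ≡
            binomial c m (λ t j → words n (suc j) (G t))
  ∑-words c m n G = binomial-∑ c m λ a t j → words n j (G t ∘ (a ∷_))

  -- A word is determined by its nonzero letters and the positions of its t zeros, chosen in C(m,t)
  -- ways. A first letter 0 feeds one branch of Pascal's rule, any other letter the second branch.
  words-split : ∀ n m (G : ℕ → List (Fin n) → ℕ) →
                words (suc n) m (λ w → G (zeros w) (nonzeros w)) ≡
                binomial 1 m (λ t j → words n j (G t))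
  words-split n zero    G = refl
  words-split n (suc m) G = cong₂ _+_
    (trans (words-split n m (G ∘ suc)) (sym (*-identityˡ _)))
    (trans (sum-cong-≗ λ a → words-split n m (λ t → G t ∘ (a ∷_))) (∑-words 1 m n G))

  lows : ∀ {n} → List (Fin (2 + n)) → ℕ
  lows w = zeros w + zeros (nonzeros w)

  highs : ∀ {n} → List (Fin (2 + n)) → List (Fin n)
  highs w = nonzeros (nonzeros w)

  length-lows : ∀ {n} (w : List (Fin (2 + n))) → lows w + length (highs w) ≡ length w
  length-lows w = begin
    lows w + length (highs w)                                ≡⟨ +-assoc (zeros w) _ _ ⟩
    zeros w + (zeros (nonzeros w) + length (highs w))        ≡⟨ cong (zeros w +_) (length-zeros (nonzeros w)) ⟩
    zeros w + length (nonzeros w)                            ≡⟨ length-zeros w ⟩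
    length w                                                 ∎

  -- Each of the t low positions now holds one of two letters, whence the weight 2ᵗ.
  words-split₂ : ∀ n m (G : ℕ → List (Fin n) → ℕ) →
                 words (2 + n) m (λ w → G (lows w) (highs w)) ≡
                 binomial 2 m (λ t j → words n j (G t))
  words-split₂ n zero    G = refl
  words-split₂ n (suc m) G = begin
    W + (words (2 + n) m (λ w → G (zeros w + suc (zeros (nonzeros w))) (highs w)) + R)
      -- A first letter 1 raises `lows` by one just as 0 does, so both contribute `W`.
      ≡⟨ cong (λ x → W + (x + R)) (words-cong (2 + n) m λ w _ → cong (λ t → G t (highs w)) (+-suc (zeros w) _)) ⟩
    W + (W + R)
      ≡⟨ solve 2 (λ x y → x :+ (x :+ y) := con 2 :* x :+ y) refl W R ⟩
    2 * W + R
      ≡⟨ cong₂ (λ x y → 2 * x + y) (words-split₂ n m (G ∘ suc))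
           (trans (sum-cong-≗ λ a → words-split₂ n m (λ t → G t ∘ (a ∷_))) (∑-words 2 m n G)) ⟩
    binomial 2 (suc m) (λ t j → words n j (G t)) ∎
    where
    W = words (2 + n) m (λ w → G (suc (lows w)) (highs w))
    R = ∑ λ a → words (2 + n) m (λ w → G (lows w) (a ∷ highs w))

  -- Words that leave the second spot unlucky.

  -- Whether, from the given state of the first spot and with the second spot
  -- free, the second spot is taken by a car that prefers it.
  secondLucky : ∀ {n} → Bool → List (Fin (2 + n)) → Bool
  secondLucky b       []                = false
  secondLucky outside (zero ∷ w)        = secondLucky inside w
  secondLucky inside  (zero ∷ w)        = false
  secondLucky b       (suc zero ∷ w)    = true
  secondLucky b       (suc (suc _) ∷ w) = secondLucky b w

  unless : Bool → ℕ → ℕ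
  unless b x = if b then 0 else x

  -- The shared case of a first letter above 1: it changes neither the state `b` nor the number of
  -- low letters, so the induction hypotheses are simply summed over that letter.
  unlucky-step : ∀ k n m b (G : ℕ → List (Fin n) → ℕ) →
    (∀ a → k * words (2 + n) m (λ w → unless (secondLucky b w) (G (lows w) (a ∷ highs w))) ≡
           binomial 2 m (λ t j → words n j (G t ∘ (a ∷_)))) →
    k * ∑ (λ a → words (2 + n) m (λ w → unless (secondLucky b w) (G (lows w) (a ∷ highs w)))) ≡
    binomial 2 m (λ t j → words n (suc j) (G t))
  unlucky-step k n m b G ih = trans (*-distribˡ-sum {n} k _) (trans (sum-cong-≗ ih) (∑-words 2 m n G))

  -- The letters below 2 of an unlucky word start with 0 0, while any other word
  -- on them with the same total is allowed by G: each forced letter costs a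
  -- factor of 2.
  unlucky-inside : ∀ n m (G : ℕ → List (Fin n) → ℕ) → (∀ w → G 0 w ≡ 0) →
    2 * words (2 + n) m (λ w → unless (secondLucky inside w) (G (lows w) (highs w))) ≡
    binomial 2 m (λ t j → words n j (G t))
  unlucky-inside n zero    G G0 = trans (cong (2 *_) (G0 [])) (sym (G0 []))
  unlucky-inside n (suc m) G G0 = begin
    2 * (S + (words (2 + n) m (λ _ → 0) + R))
      -- The vanishing block is the first letter 1, whose car makes the second spot lucky.
      ≡⟨ cong (λ x → 2 * (S + (x + R))) (words-0 (2 + n) m) ⟩
    2 * (S + R)
      ≡⟨ *-distribˡ-+ 2 S R ⟩
    2 * S + 2 * R
      -- After a first letter 0 the second spot is lost, so the remaining letters are unrestricted.
      ≡⟨ cong₂ (λ x y → 2 * x + y) (words-split₂ n m (G ∘ suc))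
           (unlucky-step 2 n m inside G λ a → unlucky-inside n m (λ t → G t ∘ (a ∷_)) (G0 ∘ (a ∷_))) ⟩
    binomial 2 (suc m) (λ t j → words n j (G t)) ∎
    where
    S = words (2 + n) m (λ w → G (suc (lows w)) (highs w))
    R = ∑ λ a → words (2 + n) m (λ w → unless (secondLucky inside w) (G (lows w) (a ∷ highs w)))

  -- The first low letter must be 0, which costs one factor of 2 and leads to the situation of
  -- `unlucky-inside`. A word with a single low letter has only this one forced letter, so `G` must
  -- vanish at 1 as well.
  unlucky-outside : ∀ n m (G : ℕ → List (Fin n) → ℕ) → (∀ w → G 0 w ≡ 0) → (∀ w → G 1 w ≡ 0) →
    4 * words (2 + n) m (λ w → unless (secondLucky outside w) (G (lows w) (highs w))) ≡
    binomial 2 m (λ t j → words n j (G t))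
  unlucky-outside n zero    G G0 G1 = trans (cong (4 *_) (G0 [])) (sym (G0 []))
  unlucky-outside n (suc m) G G0 G1 = begin
    4 * (S + (words (2 + n) m (λ _ → 0) + R))
      ≡⟨ cong (λ x → 4 * (S + (x + R))) (words-0 (2 + n) m) ⟩
    4 * (S + R)
      ≡⟨ solve 2 (λ s r → con 4 :* (s :+ r) := con 2 :* (con 2 :* s) :+ con 4 :* r) refl S R ⟩
    2 * (2 * S) + 4 * R
      ≡⟨ cong₂ (λ x y → 2 * x + y) (unlucky-inside n m (G ∘ suc) G1)
           (unlucky-step 4 n m outside G λ a →
             unlucky-outside n m (λ t → G t ∘ (a ∷_)) (G0 ∘ (a ∷_)) (G1 ∘ (a ∷_))) ⟩
    binomial 2 (suc m) (λ t j → words n j (G t)) ∎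
    where
    S = words (2 + n) m (λ w → unless (secondLucky inside w) (G (suc (lows w)) (highs w)))
    R = ∑ λ a → words (2 + n) m (λ w → unless (secondLucky outside w) (G (lows w) (a ∷ highs w)))

  -- Overflow of the street.

  -- The number of cars leaving the street when, in addition to the cars with
  -- preferences w, x cars arrive from before the first spot.
  overflow : ∀ {n} → Subset n → ℕ → List (Fin n) → ℕ
  overflow []            x w = x
  overflow (outside ∷ s) x w = overflow s (pred (x + zeros w)) (nonzeros w)
  overflow (inside  ∷ s) x w = overflow s (x + zeros w) (nonzeros w)

  -- Each of the `n` free spots absorbs at most one car.
  length≤overflow : ∀ n x (w : List (Fin n)) → x + length w ≤ n + overflow (⊥ {n}) x w
  length≤overflow zero    x []      = ≤-reflexive (+-identityʳ x)
  length≤overflow (suc n) x w = subst (_≤ suc n + overflow (⊥ {suc n}) x w)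
    (trans (+-assoc x (zeros w) _) (cong (x +_) (length-zeros w)))
    (≤-trans (+-monoˡ-≤ _ (k≤1+pred[k] k)) (s≤s (length≤overflow n (pred k) (nonzeros w))))
    where
    k = x + zeros w
    k≤1+pred[k] : ∀ k → k ≤ suc (pred k)
    k≤1+pred[k] zero    = z≤n
    k≤1+pred[k] (suc k) = ≤-refl

  isZero : ℕ → ℕ
  isZero zero    = 1
  isZero (suc _) = 0

  isZero-overflow : ∀ n x (w : List (Fin n)) → n < x + length w → isZero (overflow (⊥ {n}) x w) ≡ 0
  isZero-overflow n x w n<x+|w| with overflow (⊥ {n}) x w | length≤overflow n x w
  ... | zero  | x+|w|≤n = contradiction (≤-trans x+|w|≤n (≤-reflexive (+-identityʳ n))) (<⇒≱ n<x+|w|)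
  ... | suc _ | _       = refl

  fits : ∀ n → ℕ → List (Fin n) → ℕ
  fits n x w = isZero (overflow (⊥ {n}) x w)

  -- Counting the words without overflow.

  words-fits-long : ∀ n x m → n < x + m → words n m (fits n x) ≡ 0
  words-fits-long n x m n<x+m = trans
    (words-cong n m λ w |w|≡m → isZero-overflow n x w (subst (λ l → n < x + l) (sym |w|≡m) n<x+m))
    (words-0 n m)

  -- The closed form (x + 1) (n + 1)^(m-1), without its subtraction: with y = n + 1
  -- it reads yᵐ − m yᵐ⁻¹, and both terms are stable under the binomial recursion.
  words-fits : ∀ n x m → x + m ≡ n → words n m (fits n x) + ∂power m (suc n) ≡ suc n ^ m
  words-fits zero    zero zero refl  = refl
  words-fits (suc n) x    m    x+m≡n = begin
    words (suc n) m (fits (suc n) x) + ∂power m (2 + n)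
      ≡⟨ cong₂ _+_ (words-split n m (λ t → fits n (pred (x + t)))) (sym (binomial-∂power 1 m (suc n))) ⟩
    binomial 1 m (λ t j → words n j (fits n (pred (x + t)))) + binomial 1 m (λ _ j → ∂power j (suc n))
      ≡⟨ binomial-+ 1 m _ _ ⟨
    binomial 1 m (λ t j → words n j (fits n (pred (x + t))) + ∂power j (suc n))
      ≡⟨ binomial-cong 1 m (λ t j t+j≡m → term (x + t) j
           (trans (+-assoc x t j) (trans (cong (x +_) t+j≡m) x+m≡n))) ⟩
    binomial 1 m (λ _ j → suc n ^ j)
      ≡⟨ binomial-power 1 m (suc n) ⟩
    (2 + n) ^ m ∎
    where
    term : ∀ k j → k + j ≡ suc n → words n j (fits n (pred k)) + ∂power j (suc n) ≡ suc n ^ j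
    -- No car reaches the first spot, so n + 1 cars remain for n spots and no word fits;
    -- `∂power (suc n) (suc n)` alone is already `suc n ^ suc n`.
    term zero    _ refl    = cong (_+ ∂power (suc n) (suc n)) (words-fits-long n 0 (suc n) ≤-refl)
    term (suc k) j 1+k+j≡n = words-fits n k j (ℕ.suc-injective 1+k+j≡n)

  -- fits after t cars have passed through two spots; for t < 2 one of these
  -- stays free, which pred does not notice.
  fitsLow : ∀ n → ℕ → List (Fin n) → ℕ
  fitsLow n zero          w = 0
  fitsLow n (suc zero)    w = 0
  fitsLow n (suc (suc t)) w = fits n t w

  -- For t ≥ 2 this is `words-fits`. For t = 1 the derivative equals the power. For t = 0 the
  -- derivative (n+2)(n+1)ⁿ⁺¹ exceeds the power (n+1)ⁿ⁺² by (n+1)ⁿ⁺¹, which is the origin of the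
  -- second term of the theorem.
  words-fitsLow : ∀ n t j → t + j ≡ 2 + n →
    words n j (fitsLow n t) + ∂power j (suc n) ≡ suc n ^ j + atZero (suc n ^ suc n) t
  words-fitsLow n zero          j refl  =
    trans (cong (_+ ∂power (2 + n) (suc n)) (words-0 n (2 + n))) (+-comm (suc n ^ suc n) _)
  words-fitsLow n (suc zero)    j refl  =
    trans (cong (_+ ∂power (suc n) (suc n)) (words-0 n (suc n))) (sym (+-identityʳ _))
  words-fitsLow n (suc (suc t)) j t+j≡n =
    trans (words-fits n t j (ℕ.suc-injective (ℕ.suc-injective t+j≡n))) (sym (+-identityʳ _))

  -- With y = m + 2, yᵐ⁺¹ - (m+1) yᵐ = yᵐ. This turns the additive identities into closed forms.
  cancel-∂power : ∀ m z r → let y = 2 + m in z + ∂power (suc m) y ≡ y ^ suc m + r → z ≡ y ^ m + r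
  cancel-∂power m z r eq = let y = 2 + m in +-cancelʳ-≡ (∂power (suc m) y) z (y ^ m + r) (trans eq
    (solve 3 (λ m p r → (con 2 :+ m) :* p :+ r := (p :+ r) :+ (con 1 :+ m) :* p) refl m (y ^ m) r))

  parking-count : ∀ m → words (suc m) (suc m) (fits (suc m) 0) ≡ (2 + m) ^ m
  parking-count m = trans
    (cancel-∂power m _ 0 (trans (words-fits (suc m) 0 (suc m) refl) (sym (+-identityʳ _))))
    (+-identityʳ _)

  -- Summing `words-fitsLow` over the low letters moves the power and its derivative from n + 1 to n
  -- + 3 and keeps the correction at t = 0 unchanged.
  fitsLow-count : ∀ n → binomial 2 (2 + n) (λ t j → words n j (fitsLow n t)) ≡
                  (3 + n) ^ suc n + suc n ^ suc n
  fitsLow-count n = cancel-∂power (suc n) (binomial 2 m F) (y ^ y) (begin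
    binomial 2 m F + ∂power m (2 + y)           ≡⟨ cong (binomial 2 m F +_) (binomial-∂power 2 m y) ⟨
    binomial 2 m F + binomial 2 m ∂P            ≡⟨ binomial-+ 2 m F ∂P ⟨
    binomial 2 m (λ t j → F t j + ∂P t j)       ≡⟨ binomial-cong 2 m (words-fitsLow n) ⟩
    binomial 2 m (λ t j → P t j + Z t j)        ≡⟨ binomial-+ 2 m P Z ⟩
    binomial 2 m P + binomial 2 m Z             ≡⟨ cong₂ _+_ (binomial-power 2 m y) (binomial-atZero 2 m (y ^ y)) ⟩
    (2 + y) ^ m + y ^ y                         ∎)
    where
    m = 2 + n
    y = suc n
    F ∂P P Z : ℕ → ℕ → ℕ
    F  t j = words n j (fitsLow n t)
    ∂P _ j = ∂power j y
    P  _ j = y ^ j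
    Z  t _ = atZero (y ^ y) t

  -- If nobody prefers the first spot, the first car preferring the second finds it free and is
  -- lucky there.
  unlucky-first-absent : ∀ {n} (w : List (Fin (2 + n))) →
    secondLucky outside w ≡ false → zeros w ≡ 0 → zeros (nonzeros w) ≡ 0
  unlucky-first-absent []                _  _  = refl
  unlucky-first-absent (suc (suc _) ∷ w) ul z0 = unlucky-first-absent w ul z0

  -- The sweep sees the numbers of 0s and of 1s separately, `fitsLow` only their total. They could
  -- disagree when 0 is absent, but then an unlucky word has no 1 either. With fewer than two low
  -- letters, more than n cars are left for the last n spots, so both sides vanish.
  unlucky-fits : ∀ n (w : List (Fin (2 + n))) → length w ≡ 2 + n →
    unless (secondLucky outside w) (fits (2 + n) 0 w) ≡
    unless (secondLucky outside w) (fitsLow n (lows w) (highs w))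
  unlucky-fits n w |w|≡2+n with secondLucky outside w in lucky
  ... | true  = refl
  ... | false = helper (zeros w) (zeros (nonzeros w)) (unlucky-first-absent w lucky) (trans (length-lows w) |w|≡2+n)
    where
    helper : ∀ k l → (k ≡ 0 → l ≡ 0) → k + l + length (highs w) ≡ 2 + n →
             fits n (pred (pred k + l)) (highs w) ≡ fitsLow n (k + l) (highs w)
    helper zero          l             l≡0 eq with refl ← l≡0 refl =
      isZero-overflow n 0 (highs w) (≤-trans (n≤1+n _) (≤-reflexive (sym eq)))
    helper (suc zero)    zero          _   eq =
      isZero-overflow n 0 (highs w) (≤-reflexive (sym (ℕ.suc-injective eq)))
    helper (suc zero)    (suc l)       _   eq = refl
    helper (suc (suc k)) l             _   eq = refl

  -- Lucky and unlucky words together make up all `P` parking functions, and 4 `U` = `P` + `R`.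
  -- Adding `P` to both sides allows this substitution without subtraction.
  lucky-count : ∀ n →
    4 * words (2 + n) (2 + n) (λ w → if secondLucky outside w then fits (2 + n) 0 w else 0) + suc n ^ suc n
    ≡ 3 * (3 + n) ^ suc n
  lucky-count n = +-cancelˡ-≡ P _ _ (begin
    P + (4 * L + R)        ≡⟨ solve 3 (λ p l r → p :+ (con 4 :* l :+ r) := con 4 :* l :+ (p :+ r)) refl P L R ⟩
    4 * L + (P + R)        ≡⟨ cong (4 * L +_) (fitsLow-count n) ⟨
    4 * L + binomial 2 k (λ t j → words n j (fitsLow n t))
      ≡⟨ cong (4 * L +_) (unlucky-outside n k (fitsLow n) (λ _ → refl) (λ _ → refl)) ⟨
    4 * L + 4 * words k k (λ w → unless (secondLucky outside w) (fitsLow n (lows w) (highs w)))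
      ≡⟨ cong (λ x → 4 * L + 4 * x) (words-cong k k (unlucky-fits n)) ⟨
    4 * L + 4 * U          ≡⟨ *-distribˡ-+ 4 L U ⟨
    4 * (L + U)            ≡⟨ cong (4 *_) (words-+ k k lucky unlucky) ⟨
    4 * words k k (λ w → lucky w + unlucky w)
      ≡⟨ cong (4 *_) (words-cong k k λ w _ → split (secondLucky outside w) (fits k 0 w)) ⟩
    4 * words k k (fits k 0)
      ≡⟨ cong (4 *_) (parking-count (suc n)) ⟩
    P + 3 * P              ∎)
    where
    k = 2 + n
    P = (3 + n) ^ suc n
    R = suc n ^ suc n
    lucky unlucky : List (Fin k) → ℕ
    lucky   w = if secondLucky outside w then fits k 0 w else 0
    unlucky w = unless (secondLucky outside w) (fits k 0 w)
    L = words k k lucky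
    U = words k k unlucky
    split : ∀ b x → (if b then x else 0) + unless b x ≡ x
    split true  x = +-identityʳ x
    split false x = refl

open Counting

-- Parking car by car compared with the sweep.

park-suc : ∀ {n} b (s : Subset n) a → park (b ∷ s) (suc a) ≡ Maybe.map suc (park s a)
park-suc outside s       a = refl
park-suc inside  (_ ∷ _) a = refl

misses : ∀ {n} → Maybe (Fin n) → ℕ
misses (just _) = 0
misses nothing  = 1

occupy-map-suc : ∀ {n} b (s : Subset n) p → occupy (b ∷ s) (Maybe.map suc p) ≡ b ∷ occupy s p
occupy-map-suc b s (just _) = refl
occupy-map-suc b s nothing  = refl

-- A car arriving from before the street behaves like one that prefers its first spot.
overflow-shift : ∀ {n} (s : Subset (suc n)) x w → overflow s (suc x) w ≡ overflow s x (zero ∷ w)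
overflow-shift (outside ∷ s) x w = cong (λ k → overflow s (pred k) (nonzeros w)) (sym (+-suc x _))
overflow-shift (inside  ∷ s) x w = cong (λ k → overflow s k (nonzeros w)) (sym (+-suc x _))

overflow-map-suc : ∀ {n} b (s : Subset n) p x w →
  misses (Maybe.map Fin.suc p) + overflow (occupy (b ∷ s) (Maybe.map suc p)) x w ≡
  misses p + overflow (b ∷ occupy s p) x w
overflow-map-suc b s (just _) x w = refl
overflow-map-suc b s nothing  x w = refl

-- The invariant linking the process to the sweep: letting one car park before sweeping does not
-- change how many cars leave, provided its own failure is counted.
overflow-park : ∀ {n} (s : Subset n) a x w →
  overflow s x (a ∷ w) ≡ misses (park s a) + overflow (occupy s (park s a)) x w
overflow-park (outside ∷ s)         zero x w =
  cong (λ k → overflow s (pred k) (nonzeros w)) (+-suc x _)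
overflow-park (inside  ∷ [])        zero x w = +-suc x _
overflow-park (inside  ∷ s@(_ ∷ _)) zero x w = begin
  overflow s (x + suc (zeros w)) (nonzeros w)    ≡⟨ cong (λ k → overflow s k (nonzeros w)) (+-suc x _) ⟩
  -- The car pushed past the full first spot becomes a car preferring the next one.
  overflow s (suc (x + zeros w)) (nonzeros w)    ≡⟨ overflow-shift s (x + zeros w) (nonzeros w) ⟩
  overflow s (x + zeros w) (zero ∷ nonzeros w)   ≡⟨ overflow-park s zero (x + zeros w) (nonzeros w) ⟩
  misses (park s zero) + overflow (inside ∷ occupy s (park s zero)) x w
    ≡⟨ overflow-map-suc inside s (park s zero) x w ⟨
  misses (Maybe.map Fin.suc (park s zero)) +
    overflow (occupy (inside ∷ s) (Maybe.map suc (park s zero))) x w ∎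
overflow-park (outside ∷ s)         (suc a) x w = trans
  (overflow-park s a (pred (x + zeros w)) (nonzeros w))
  (sym (overflow-map-suc outside s (park s a) x w))
overflow-park (inside  ∷ s@(_ ∷ _)) (suc a) x w = trans
  (overflow-park s a (x + zeros w) (nonzeros w))
  (sym (overflow-map-suc inside s (park s a) x w))

overflow-[] : ∀ {n} (s : Subset n) → overflow s 0 [] ≡ 0
overflow-[] []            = refl
overflow-[] (outside ∷ s) = overflow-[] s
overflow-[] (inside  ∷ s) = overflow-[] s

-- Generalises `IsParkingFunction` to any initial street and number of cars, for induction along the
-- cars.
AllPark : ∀ {n m} → Subset n → Vec (Fin n) m → Set
AllPark s v = ∀ i → ∃[ j ] lookup (outcome s v) i ≡ just j

-- Iterating `overflow-park` expresses the overflow as the number of cars that fail; the converse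
-- below reads the same sum backwards.
allPark⇒overflow≡0 : ∀ {n m} (s : Subset n) (v : Vec (Fin n) m) → AllPark s v → overflow s 0 (toList v) ≡ 0
allPark⇒overflow≡0 s []      _    = overflow-[] s
allPark⇒overflow≡0 s (a ∷ v) parks = trans (overflow-park s a 0 (toList v)) (cong₂ _+_
  (cong misses (proj₂ (parks zero)))
  (allPark⇒overflow≡0 (occupy s (park s a)) v (parks ∘ suc)))

overflow≡0⇒allPark : ∀ {n m} (s : Subset n) (v : Vec (Fin n) m) → overflow s 0 (toList v) ≡ 0 → AllPark s v
overflow≡0⇒allPark s (a ∷ v) none = λ where
    zero    → parked (park s a) (m+n≡0⇒m≡0 _ none′)
    (suc i) → overflow≡0⇒allPark (occupy s (park s a)) v (m+n≡0⇒n≡0 (misses (park s a)) none′) i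
  where
  none′ = trans (sym (overflow-park s a 0 (toList v))) none
  parked : ∀ p → misses p ≡ 0 → ∃[ j ] p ≡ just j
  parked (just j) _ = j , refl

-- No spot is taken twice.

map-suc-just : ∀ {n} (p : Maybe (Fin n)) {j} → Maybe.map Fin.suc p ≡ just j →
               ∃[ k ] (p ≡ just k × j ≡ suc k)
map-suc-just (just k) refl = k , refl , refl

park-free : ∀ {n} (s : Subset n) a {j} → park s a ≡ just j → lookup s j ≡ outside
park-free (outside ∷ s)         zero    refl = refl
park-free (inside  ∷ s@(_ ∷ _)) zero    eq with k , eq′ , refl ← map-suc-just (park s zero) eq =
  park-free s zero eq′
park-free (b       ∷ s)         (suc a) eq
  with k , eq′ , refl ← map-suc-just (park s a) (trans (sym (park-suc b s a)) eq) = park-free s a eq′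

occupy-inside : ∀ {n} (s : Subset n) p j → lookup s j ≡ inside → lookup (occupy s p) j ≡ inside
occupy-inside s nothing  j s[j] = s[j]
occupy-inside s (just k) j s[j] with j ≟ k
... | yes refl = lookup∘update k s inside
... | no  j≢k  = trans (lookup∘update′ j≢k s inside) s[j]

occupied⇒not-parked : ∀ {n m} (s : Subset n) (v : Vec (Fin n) m) i j →
  lookup s j ≡ inside → lookup (outcome s v) i ≢ just j
occupied⇒not-parked s (a ∷ v) zero    j s[j] parks =
  contradiction (trans (sym s[j]) (park-free s a parks)) λ ()
occupied⇒not-parked s (a ∷ v) (suc i) j s[j] =
  occupied⇒not-parked (occupy s (park s a)) v i j (occupy-inside s (park s a) j s[j])

park-occupies : ∀ {n} (s : Subset n) {p j} → p ≡ just j → lookup (occupy s p) j ≡ inside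
park-occupies s {j = j} refl = lookup∘update j s inside

-- A spot once taken stays occupied, and cars park only in free spots, so the later of two cars
-- could not share it.
outcome-injective : ∀ {n m} (s : Subset n) (v : Vec (Fin n) m) i i′ {j} →
  lookup (outcome s v) i ≡ just j → lookup (outcome s v) i′ ≡ just j → i ≡ i′
outcome-injective s (a ∷ v) zero    zero     _  _  = refl
outcome-injective s (a ∷ v) zero    (suc i′) p  p′ =
  contradiction p′ (occupied⇒not-parked _ v i′ _ (park-occupies s p))
outcome-injective s (a ∷ v) (suc i) zero     p  p′ =
  contradiction p (occupied⇒not-parked _ v i _ (park-occupies s p′))
outcome-injective s (a ∷ v) (suc i) (suc i′) p  p′ = cong suc (outcome-injective _ v i i′ p p′)

-- Luck of the second spot in the parking process.

SecondLucky : ∀ {n m} → Subset (2 + n) → Vec (Fin (2 + n)) m → Set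
SecondLucky s v = ∃[ i ] (lookup (outcome s v) i ≡ just (suc zero) × lookup v i ≡ suc zero)

-- Cars move only forward, so one aiming past the second spot preserves the state that `secondLucky`
-- tracks.
occupy-beyond : ∀ {n} b c (s : Subset n) a →
  let s′ = b ∷ c ∷ s in occupy s′ (park s′ (suc (suc a))) ≡ b ∷ c ∷ occupy s (park s a)
occupy-beyond b c s a = begin
  occupy (b ∷ c ∷ s) (park (b ∷ c ∷ s) (suc (suc a)))
    ≡⟨ cong (occupy (b ∷ c ∷ s)) (trans (park-suc b (c ∷ s) (suc a)) (cong (Maybe.map suc) (park-suc c s a))) ⟩
  occupy (b ∷ c ∷ s) (Maybe.map suc (Maybe.map suc (park s a)))
    ≡⟨ occupy-map-suc b (c ∷ s) (Maybe.map suc (park s a)) ⟩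
  b ∷ occupy (c ∷ s) (Maybe.map suc (park s a))
    ≡⟨ cong (b ∷_) (occupy-map-suc c s (park s a)) ⟩
  b ∷ c ∷ occupy s (park s a) ∎

secondLucky-sound : ∀ {n m} b (s : Subset n) (v : Vec (Fin (2 + n)) m) →
  secondLucky b (toList v) ≡ true → SecondLucky (b ∷ outside ∷ s) v
secondLucky-sound outside s (zero ∷ v) lucky
  with i , p ← secondLucky-sound inside s v lucky = suc i , p
secondLucky-sound outside s (suc zero ∷ v) lucky = zero , refl , refl
secondLucky-sound inside  s (suc zero ∷ v) lucky = zero , refl , refl
secondLucky-sound outside s (suc (suc a) ∷ v) lucky
  with i , p ← subst (λ s′ → SecondLucky s′ v) (sym (occupy-beyond outside outside s a))
                 (secondLucky-sound outside (occupy s (park s a)) v lucky) = suc i , p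
secondLucky-sound inside  s (suc (suc a) ∷ v) lucky
  with i , p ← subst (λ s′ → SecondLucky s′ v) (sym (occupy-beyond inside outside s a))
                 (secondLucky-sound inside (occupy s (park s a)) v lucky) = suc i , p

secondLucky-complete : ∀ {n m} b (s : Subset n) (v : Vec (Fin (2 + n)) m) →
  SecondLucky (b ∷ outside ∷ s) v → secondLucky b (toList v) ≡ true
secondLucky-complete outside s (zero ∷ v)     (suc i , p)     = secondLucky-complete inside s v (i , p)
-- This car is pushed into the second spot without preferring it, and no later car can park there.
secondLucky-complete inside  s (zero ∷ v)     (suc i , p , _) =
  contradiction p (occupied⇒not-parked (inside ∷ inside ∷ s) v i (suc zero) refl)
secondLucky-complete outside s (suc zero ∷ v) _           = refl
secondLucky-complete inside  s (suc zero ∷ v) _           = refl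
secondLucky-complete outside s (suc (suc a) ∷ v) (suc i , p) =
  secondLucky-complete outside (occupy s (park s a)) v
    (subst (λ s′ → SecondLucky s′ v) (occupy-beyond outside outside s a) (i , p))
secondLucky-complete inside  s (suc (suc a) ∷ v) (suc i , p) =
  secondLucky-complete inside (occupy s (park s a)) v
    (subst (λ s′ → SecondLucky s′ v) (occupy-beyond inside outside s a) (i , p))

-- Counts as sums of indicators.

indicator : ∀ {P : Set} → Dec P → ℕ
indicator P? = if does P? then 1 else 0

indicator-unique : ∀ {P : Set} (P? : Dec P) {x} → (P → x ≡ 1) → (¬ P → x ≡ 0) → indicator P? ≡ x
indicator-unique (yes p) one _    = sym (one p)
indicator-unique (no ¬p) _   none = sym (none ¬p)

∑-indicator-0 : ∀ {n} {P : Fin n → Set} (P? : Decidable P) → (∀ i → ¬ P i) → ∑ (indicator ∘ P?) ≡ 0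
∑-indicator-0 {n} P? none = trans
  (sum-cong-≗ λ i → indicator-unique (P? i) (λ p → contradiction p (none i)) λ _ → refl)
  (sum-replicate-zero n)

∑-indicator-1 : ∀ {n} {P : Fin n → Set} (P? : Decidable P) →
                (∀ {i j} → P i → P j → i ≡ j) → ∀ i → P i → ∑ (indicator ∘ P?) ≡ 1
∑-indicator-1 P? unique zero p = cong₂ _+_
  (indicator-unique (P? zero) (λ _ → refl) (contradiction p))
  (∑-indicator-0 (P? ∘ suc) λ i q → contradiction (unique p q) λ ())
∑-indicator-1 P? unique (suc i) p = cong₂ _+_
  (indicator-unique (P? zero) (λ q → contradiction (unique p q) λ ()) (λ _ → refl))
  (∑-indicator-1 (P? ∘ suc) (λ q r → suc-injective (unique q r)) i p)

length-filter : ∀ {A : Set} {P : A → Set} (P? : Decidable P) xs →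
                length (filter P? xs) ≡ sum (map (indicator ∘ P?) xs)
length-filter P? []       = refl
length-filter P? (x ∷ xs) with does (P? x)
... | true  = cong suc (length-filter P? xs)
... | false = length-filter P? xs

sum-tabulate : ∀ {n} (f : Fin n → ℕ) → sum (tabulate f) ≡ ∑ f
sum-tabulate {zero}  f = refl
sum-tabulate {suc n} f = cong (f zero +_) (sum-tabulate (f ∘ suc))

sum-map-allFin : ∀ {n} (f : Fin n → ℕ) → sum (map f (allFin n)) ≡ ∑ f
sum-map-allFin f = trans (cong sum (map-tabulate id f)) (sum-tabulate f)

∑-sum-map : ∀ {A : Set} {n} (f : Fin n → A → ℕ) xs →
            ∑ (λ i → sum (map (f i) xs)) ≡ sum (map (λ x → ∑ (λ i → f i x)) xs)
∑-sum-map {n = n} f []       = sum-replicate-zero n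
∑-sum-map         f (x ∷ xs) = trans
  (∑-distrib-+ (λ i → f i x) _)
  (cong (∑ (λ i → f i x) +_) (∑-sum-map f xs))

-- Stated for `tabulate t` instead of `allFin`, since the tail of `allFin` is no longer of that form
-- in the induction.
sum-map-cartesian : ∀ {A : Set} {n m} (t : Fin n → A) (h : Vec A (suc m) → ℕ) vs →
  sum (map h (cartesianProductWith _∷_ (tabulate t) vs)) ≡ ∑ (λ i → sum (map (h ∘ (t i ∷_)) vs))
sum-map-cartesian {n = zero}  t h vs = refl
sum-map-cartesian {n = suc n} t h vs = begin
  sum (map h (map (t zero ∷_) vs ++ rest))
    ≡⟨ cong sum (map-++ h (map (t zero ∷_) vs) rest) ⟩
  sum (map h (map (t zero ∷_) vs) ++ map h rest)
    ≡⟨ sum-++ (map h (map (t zero ∷_) vs)) (map h rest) ⟩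
  sum (map h (map (t zero ∷_) vs)) + sum (map h rest)
    ≡⟨ cong₂ _+_ (cong sum (sym (map-∘ vs))) (sum-map-cartesian (t ∘ suc) h vs) ⟩
  ∑ (λ i → sum (map (h ∘ (t i ∷_)) vs)) ∎
  where rest = cartesianProductWith _∷_ (tabulate (t ∘ suc)) vs

sum-allVecs : ∀ n m (g : List (Fin n) → ℕ) →
              sum (map (g ∘ toList) (allVecs (allFin n) m)) ≡ words n m g
sum-allVecs n zero    g = +-identityʳ _
sum-allVecs n (suc m) g = trans
  (sum-map-cartesian id (g ∘ toList) (allVecs (allFin n) m))
  (sum-cong-≗ λ a → sum-allVecs n m (g ∘ (a ∷_)))

-- The counts of the theorem.

-- Double counting: by `outcome-injective` at most one car parks in spot `j`, so each parking
-- function with that spot lucky is counted for exactly one car.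
luckySpotCount≡∑q : ∀ n j → luckySpotCount n j ≡ sum (map (λ i → q n i j) (allFin n))
luckySpotCount≡∑q n j = begin
  luckySpotCount n j
    ≡⟨ length-filter (λ a → isParkingFunction? a ×-dec luckySpot? a j) vs ⟩
  sum (map (λ a → indicator (isParkingFunction? a ×-dec luckySpot? a j)) vs)
    ≡⟨ cong sum (map-cong pointwise vs) ⟩
  sum (map (λ a → ∑ (λ i → indicator (luckyAt? i a))) vs)
    ≡⟨ ∑-sum-map (λ i a → indicator (luckyAt? i a)) vs ⟨
  ∑ (λ i → sum (map (λ a → indicator (luckyAt? i a)) vs))
    ≡⟨ sum-cong-≗ (λ i → length-filter (luckyAt? i) vs) ⟨
  ∑ (λ i → q n i j)
    ≡⟨ sum-map-allFin (λ i → q n i j) ⟨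
  sum (map (λ i → q n i j) (allFin n)) ∎
  where
  vs = allVecs (allFin n) n
  LuckyAt : Fin n → Preferences n → Set
  LuckyAt i a = IsParkingFunction a × (lookup a i ≡ j × LuckyCar a i)
  luckyAt? : ∀ i → Decidable (LuckyAt i)
  luckyAt? i a = isParkingFunction? a ×-dec ((lookup a i ≟ j) ×-dec luckyCar? a i)
  unique : ∀ a {i i′} → LuckyAt i a → LuckyAt i′ a → i ≡ i′
  unique a {i} {i′} (_ , a[i] , p) (_ , a[i′] , p′) =
    outcome-injective ⊥ a i i′ (trans p (cong just a[i])) (trans p′ (cong just a[i′]))
  pointwise : ∀ a → indicator (isParkingFunction? a ×-dec luckySpot? a j) ≡ ∑ (λ i → indicator (luckyAt? i a))
  pointwise a = indicator-unique (isParkingFunction? a ×-dec luckySpot? a j)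
    (λ (pf , i , p , a[i]) → ∑-indicator-1 (λ i → luckyAt? i a) (unique a) i
      (pf , a[i] , trans p (cong just (sym a[i]))))
    (λ ¬lucky → ∑-indicator-0 (λ i → luckyAt? i a) λ i (pf , a[i] , p) →
      ¬lucky (pf , i , trans p (cong just a[i]) , a[i]))

-- Both conditions are read off the word: parking of all cars from its overflow, luck of the spot
-- from `secondLucky`.
luckySpotCount-second : ∀ n → luckySpotCount (2 + n) (suc zero) ≡
  words (2 + n) (2 + n) (λ w → if secondLucky outside w then fits (2 + n) 0 w else 0)
luckySpotCount-second n = begin
  luckySpotCount (2 + n) (suc zero)
    ≡⟨ length-filter P? (allVecs (allFin (2 + n)) (2 + n)) ⟩
  sum (map (indicator ∘ P?) (allVecs (allFin (2 + n)) (2 + n)))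
    ≡⟨ cong sum (map-cong pointwise (allVecs (allFin (2 + n)) (2 + n))) ⟩
  sum (map (g ∘ toList) (allVecs (allFin (2 + n)) (2 + n)))
    ≡⟨ sum-allVecs (2 + n) (2 + n) g ⟩
  words (2 + n) (2 + n) g ∎
  where
  P? : Decidable (λ a → IsParkingFunction a × LuckySpot a (suc zero))
  P? a = isParkingFunction? {2 + n} a ×-dec luckySpot? a (suc zero)
  g : List (Fin (2 + n)) → ℕ
  g w = if secondLucky outside w then fits (2 + n) 0 w else 0
  pointwise : ∀ a → indicator (P? a) ≡ g (toList a)
  pointwise a = indicator-unique (P? a) one none
    where
    one : IsParkingFunction a × LuckySpot a (suc zero) → g (toList a) ≡ 1
    one (pf , lucky) = cong₂ (λ b x → if b then isZero x else 0)
      (secondLucky-complete outside ⊥ a lucky) (allPark⇒overflow≡0 ⊥ a pf)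
    none : ¬ (IsParkingFunction a × LuckySpot a (suc zero)) → g (toList a) ≡ 0
    none ¬p with secondLucky outside (toList a) in lucky
    ... | false = refl
    ... | true with overflow ⊥ 0 (toList a) in pf
    ...   | zero  = contradiction (overflow≡0⇒allPark ⊥ a pf , secondLucky-sound outside ⊥ a lucky) ¬p
    ...   | suc _ = refl

-- Passage to rational numbers.

open import Data.Integer using (+_)
open import Data.Rational using (_/_; _*_; _-_)

-- The cross-multiplied form of the fraction identity: 16 = 4 · 4 is the unreduced denominator of
-- the difference of two quarters.
quarters-numerators : ∀ x a b → 4 ℕ.* x + b ≡ 3 ℕ.* a →
  + x ℤ.* + 16 ≡ ((+ 3 ℤ.* + a) ℤ.* + 4 ℤ.+ (ℤ.- (+ 1 ℤ.* + b)) ℤ.* + 4) ℤ.* + 1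
quarters-numerators x a b 4x+b≡3a = begin
  + x ℤ.* + 16
    ≡⟨ solve 2 (λ x b → x :* con (+ 16) := ((con (+ 4) :* x :+ b) :- b) :* con (+ 4)) refl (+ x) (+ b) ⟩
  ((+ 4 ℤ.* + x ℤ.+ + b) ℤ.- + b) ℤ.* + 4
    ≡⟨ cong (λ z → (z ℤ.- + b) ℤ.* + 4) lifted ⟩
  (+ 3 ℤ.* + a ℤ.- + b) ℤ.* + 4
    ≡⟨ solve 2 (λ a b → (con (+ 3) :* a :- b) :* con (+ 4) :=
         ((con (+ 3) :* a) :* con (+ 4) :+ (:- (con (+ 1) :* b)) :* con (+ 4)) :* con (+ 1)) refl (+ a) (+ b) ⟩
  ((+ 3 ℤ.* + a) ℤ.* + 4 ℤ.+ (ℤ.- (+ 1 ℤ.* + b)) ℤ.* + 4) ℤ.* + 1 ∎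
  where
  open ℤ-Solver
  lifted : + 4 ℤ.* + x ℤ.+ + b ≡ + 3 ℤ.* + a
  lifted = trans (cong (λ z → z ℤ.+ + b) (sym (ℤ.pos-* 4 x))) (trans (cong +_ 4x+b≡3a) (ℤ.pos-* 3 a))

-- Unnormalised fractions are used because reduction by a gcd does not compute on variable
-- numerators.
quarters : ∀ x a b → 4 ℕ.* x + b ≡ 3 ℕ.* a →
  (+ x) / 1 ≡ ((+ 3) / 4) * ((+ a) / 1) - ((+ 1) / 4) * ((+ b) / 1)
quarters x a b 4x+b≡3a = ℚ.toℚᵘ-injective (begin′
  toℚᵘ ((+ x) / 1)                       ≈⟨ ℚ.toℚᵘ-fromℚᵘ (int x) ⟩
  int x                                  ≈⟨ *≡* (quarters-numerators x a b 4x+b≡3a) ⟩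
  ¾ ℚᵘ.* int a ℚᵘ.- ¼ ℚᵘ.* int b
    ≈⟨ ℚᵘ.+-cong (product 3 a) (ℚᵘ.-‿cong (product 1 b)) ⟨
  toℚᵘ ¾a ℚᵘ.- toℚᵘ ¼b
    ≈⟨ ℚᵘ.+-congʳ (toℚᵘ ¾a) (ℚ.toℚᵘ-homo‿- ¼b) ⟨
  toℚᵘ ¾a ℚᵘ.+ toℚᵘ (ℚ.- ¼b)             ≈⟨ ℚ.toℚᵘ-homo-+ ¾a (ℚ.- ¼b) ⟨
  toℚᵘ (¾a - ¼b)                         ∎′)
  where
  open import Relation.Binary.Reasoning.Setoid ℚᵘ.≃-setoid renaming (begin_ to begin′_; _∎ to _∎′)
  ¾a = ((+ 3) / 4) * ((+ a) / 1)
  ¼b = ((+ 1) / 4) * ((+ b) / 1)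
  int : ℕ → ℚᵘ
  int y = mkℚᵘ (+ y) 0
  ¾ ¼ : ℚᵘ
  ¾ = mkℚᵘ (+ 3) 3
  ¼ = mkℚᵘ (+ 1) 3
  product : ∀ k y → toℚᵘ (((+ k) / 4) * ((+ y) / 1)) ≃ mkℚᵘ (+ k) 3 ℚᵘ.* int y
  product k y = ℚᵘ.≃-trans (ℚ.toℚᵘ-homo-* ((+ k) / 4) ((+ y) / 1))
    (ℚᵘ.*-cong (ℚ.toℚᵘ-fromℚᵘ (mkℚᵘ (+ k) 3)) (ℚ.toℚᵘ-fromℚᵘ (int y)))

theorem3p1 : (n : ℕ) (2≤n : 2 ≤ n) →
    let second = fromℕ< {1} 2≤n
        total = sum (map (λ i → q n i second) (allFin n))
    in (luckySpotCount n second ≡ total)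
       × ((+ total) / 1
           ≡ ((+ 3) / 4) * ((+ ((n + 1) ^ (n ∸ 1))) / 1)
             - ((+ 1) / 4) * ((+ ((n ∸ 1) ^ (n ∸ 1))) / 1))
theorem3p1 (suc (suc n)) (s≤s (s≤s z≤n)) = count≡total , quarters total (k ^ suc n) (suc n ^ suc n) (begin
  4 ℕ.* total + suc n ^ suc n
    ≡⟨ cong (λ x → 4 ℕ.* x + suc n ^ suc n) (trans (sym count≡total) (luckySpotCount-second n)) ⟩
  4 ℕ.* words (2 + n) (2 + n) (λ w → if secondLucky outside w then fits (2 + n) 0 w else 0) + suc n ^ suc n
    ≡⟨ lucky-count n ⟩
  3 ℕ.* (3 + n) ^ suc n
    ≡⟨ cong (λ y → 3 ℕ.* y ^ suc n) (+-comm 1 (2 + n)) ⟩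
  3 ℕ.* k ^ suc n ∎)
  where
  k = 2 + n + 1
  total = sum (map (λ i → q (2 + n) i (suc zero)) (allFin (2 + n)))
  count≡total = luckySpotCount≡∑q (2 + n) (suc zero)
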